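{- If the layerwidth of a DAG $G$ is $w$, then the bandwidth of $G$ is less than or equal to $2w-1$. Furthermore, this bound is tight: for every integer $w\ge1$ there exists a DAG $G$ with layerwidth $w$ and bandwidth $2w-1$.
   Context: All graphs are finite and have at least one node. A layer decomposition of a DAG $G=(V,A)$ is a list $((T^0,S^0),\dots,(T^k,S^k))$ of pairs of subsets of $V$ such that: (D1) $(T^0,\dots,T^k)$ is an ordered partition of $V$ (into nonempty blocks); (D2) $S^i\subseteq T^i$ for every $i\in\{0,\dots,k\}$; (D3) for every $i\in\{0,\dots,k-1\}$, no two variables $X\in T^0\cup\dots\cup T^{i-1}\cup(T^i\setminus S^i)$ and $Y\in T^{i+1}\cup\dots\cup T^k$ are connected by an arrow in $G$; (D4) for every $i\in\{1,\dots,k\}$, every child in $G$ of a variable in $S^i$ belongs to $(T^i\setminus S^i)\cup S^{i-1}$, and every child of a variable in $S^0$ belongs to $T^0\setminus S^0$; (D5) for every $i\in\{0,\dots,k-1\}$, every parent in $G$ of a variable in $S^i$ belongs to $T^{i+1}$, and no variable in $S^k$ has a parent. The width of a layer decomposition is the lowest integer $w$ such that $|T^i|\le w$ for every $i\in\{0,\dots,k\}$. The layerwidth of $G$ is the minimum width over all layer decompositions of $G$. Bandwidth of a DAG $G=(V,A)$: a topological order of $G$ is an ordering of $V$ such that every parent appears before each of its children. The width of a topological order is the maximum, over all arrows of $G$, of the distance (difference of positions) between the parent and the child in the order (and $0$ if there are no arrows). The bandwidth of $G$ is the lowest width among all topological orders of $G$. -}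

module Defs where

open import Data.Fin using (Fin; zero; suc; toℕ; fromℕ; inject₁; _<_)
open import Data.Fin.Permutation using (Permutation′; _⟨$⟩ʳ_)
open import Data.Fin.Subset using (Subset; _∈_; _⊆_; _∪_; _─_; ∣_∣; Nonempty)
open import Data.List.Base using (List; map; filter; allFin; cartesianProduct)
open import Data.List.Extrema.Nat using (max)
open import Data.Nat.Base using (ℕ; suc; NonZero; _≤_; ∣_-_∣)
open import Data.Product using (_×_; ∃; ∃-syntax; uncurry)
open import Data.Sum using (_⊎_)
open import Level using (Level; 0ℓ)
open import Relation.Binary using (Rel; Decidable)
open import Relation.Binary.Construct.Closure.Transitive using (TransClosure)
open import Relation.Binary.PropositionalEquality using (_≡_)
open import Relation.Nullary using (¬_)

IsLeast : ∀ {ℓ : Level} → (ℕ → Set ℓ) → ℕ → Set ℓ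
IsLeast P m = P m × (∀ m′ → P m′ → m ≤ m′)

record DAG : Set₁ where
  infix 4 _⟶_ _⟶?_
  field
    order    : ℕ
    nonEmpty : NonZero order

  Node : Set
  Node = Fin order

  field
    -- X ⟶ Y: X is a parent of Y, and Y is a child of X.
    _⟶_     : Rel Node 0ℓ
    _⟶?_    : Decidable _⟶_
    acyclic : ∀ X → ¬ TransClosure _⟶_ X X

  arrows : List (Node × Node)
  arrows = filter (uncurry _⟶?_) (cartesianProduct (allFin order) (allFin order))

-- The layers are indexed by Fin (suc k).  An index i of Fin k stands for the
-- pair of consecutive layers inject₁ i and suc i.
record LayerDecomposition (G : DAG) : Set where
  open DAG G
  field
    k   : ℕ
    T S : Fin (suc k) → Subset order

    D1-nonempty : ∀ i → Nonempty (T i)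
    D1-cover    : ∀ X → ∃[ i ] X ∈ T i
    D1-disjoint : ∀ {i j X} → X ∈ T i → X ∈ T j → i ≡ j

    D2 : ∀ i → S i ⊆ T i

    D3 : ∀ (i : Fin k) {X Y} →
         (∃[ j ] (j < inject₁ i × X ∈ T j)) ⊎ X ∈ T (inject₁ i) ─ S (inject₁ i) →
         ∃[ j ] (inject₁ i < j × Y ∈ T j) →
         ¬ (X ⟶ Y) × ¬ (Y ⟶ X)

    D4-suc  : ∀ (i : Fin k) {X Y} → X ∈ S (suc i) → X ⟶ Y →
              Y ∈ (T (suc i) ─ S (suc i)) ∪ S (inject₁ i)
    D4-zero : ∀ {X Y} → X ∈ S zero → X ⟶ Y → Y ∈ T zero ─ S zero

    D5-inject₁ : ∀ (i : Fin k) {X Y} → Y ∈ S (inject₁ i) → X ⟶ Y → X ∈ T (suc i)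
    D5-last    : ∀ {X Y} → Y ∈ S (fromℕ k) → ¬ (X ⟶ Y)

  HasWidth : ℕ → Set
  HasWidth = IsLeast (λ w → ∀ i → ∣ T i ∣ ≤ w)

HasLayerwidth : DAG → ℕ → Set
HasLayerwidth G = IsLeast (λ w → ∃ λ (L : LayerDecomposition G) → LayerDecomposition.HasWidth L w)

record TopologicalOrder (G : DAG) : Set where
  open DAG G
  field
    ordering : Permutation′ order

  position : Node → Fin order
  position X = ordering ⟨$⟩ʳ X

  field
    topological : ∀ {X Y} → X ⟶ Y → position X < position Y

  distance : Node → Node → ℕ
  distance X Y = ∣ toℕ (position X) - toℕ (position Y) ∣

  width : ℕ
  width = max 0 (map (uncurry distance) arrows)

HasBandwidth : DAG → ℕ → Set
HasBandwidth G = IsLeast (λ b → ∃ λ (σ : TopologicalOrder G) → TopologicalOrder.width σ ≡ b)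

{-# OPTIONS --safe #-}
-- In a layer decomposition every arrow stays inside a layer T^i or leads from
-- T^{i+1} to T^i.  So some topological order lists the layers T^k, …, T^0 one
-- after the other, and the nodes in the half-open interval from X to Y, for an
-- arrow X ⟶ Y, belong to at most two layers and exclude Y: at most 2w - 1 nodes.
-- The bound is attained by the complete bipartite DAG with w sources and w
-- sinks, whose two sides are its layers: every topological order starts with a
-- source, ends with a sink, and these two are joined by an arrow.
module Submission where

open import Defs
open import Data.Nat.Base using (ℕ; _*_; _∸_; _≤_)
open import Data.Product using (_×_; ∃; ∃-syntax)

open import Data.Fin
  using (Fin; zero; suc; toℕ; fromℕ; fromℕ<; inject₁; punchOut; funToFin; finToFun; _↑ʳ_; _>_)
  renaming (_<_ to _<ᶠ_)
open import Data.Fin.Induction using (spo-wellFounded; >-wellFounded)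
import Data.Fin.Properties as Fin
open import Data.Fin.Permutation using (Permutation′; _⟨$⟩ˡ_; inverseˡ; inverseʳ)
open import Data.Fin.Relation.Unary.Top using (view; ‵fromℕ; ‵inject₁)
open import Data.Fin.Subset using (Subset; _∈_; _∉_; _⊆_; _∪_; _─_; ∣_∣; ⁅_⁆; Nonempty; inside; outside; ⊤; ⊥; ∁)
open import Data.Fin.Subset.Properties
open import Data.List.Base using (map; allFin; cartesianProduct)
open import Data.List.Extrema.Nat using (max; max≤v⁺; xs≤max)
open import Data.List.Membership.Propositional.Properties
  using (∈-allFin; ∈-map⁺; ∈-filter⁺; ∈-cartesianProduct⁺)
open import Data.List.Properties using (map-cong)
import Data.List.Relation.Unary.All as All
import Data.List.Relation.Unary.All.Properties as All
open import Data.Nat.Base using (zero; suc; _+_; _^_; _<_; z≤n; s≤s; s≤s⁻¹; ∣_-_∣)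
open import Data.Nat.Induction using (<-rec)
import Data.Nat.Properties as ℕ
open import Data.Product using (_,_; proj₁; proj₂; uncurry)
open import Data.Product.Relation.Binary.Lex.Strict
  using (×-Lex; ×-decidable; ×-wellFounded; ×-isStrictTotalOrder)
open import Data.Sum using (_⊎_; inj₁; inj₂; [_,_]′)
open import Data.Vec.Base using (_∷_; []; _++_; tabulate; here; there)
open import Data.Vec.Properties using (lookup∘tabulate; lookup⇒[]=; []=⇒lookup; lookup-++ʳ)
open import Function.Base using (_∘_; _on_)
open import Function.Bundles using (mk↔ₛ′)
open import Function.Definitions using (Injective)
open import Induction.WellFounded using (Acc; acc; WellFounded)
open import Level using (Level; 0ℓ)
open import Relation.Binary using (Rel; Decidable; IsStrictTotalOrder; Trichotomous; tri<; tri≈; tri>; _⇒_)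
import Relation.Binary.Construct.On as On
open import Relation.Binary.Construct.Closure.Transitive
  using (TransClosure; [_]; _∷_; transitive; wellFounded⁻)
open import Relation.Binary.PropositionalEquality
open import Relation.Nullary using (¬_; Dec; yes; no; does; contradiction)
open import Relation.Nullary.Decidable using (map′; _×-dec_; _→-dec_; ¬?; dec-true)

private
  variable
    a ℓ : Level
    A : Set a
    m n : ℕ

-- Strong induction on `b`: either no smaller number satisfies `P`, and `b` is least, or the search
-- restarts from a smaller witness.
least : {P : ℕ → Set ℓ} → (∀ b → Dec (P b)) → ∀ b → P b → ∃[ b′ ] (IsLeast P b′ × b′ ≤ b)
least {P = P} P? = <-rec _ λ b smaller Pb → go b smaller Pb
  where
  go : ∀ b → (∀ {c} → c < b → P c → ∃[ b′ ] (IsLeast P b′ × b′ ≤ c)) → P b →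
       ∃[ b′ ] (IsLeast P b′ × b′ ≤ b)
  go b smaller Pb with ℕ.anyUpTo? P? b
  ... | no ∄c = b , (Pb , λ c Pc → ℕ.≮⇒≥ λ c<b → ∄c (c , c<b , Pc)) , ℕ.≤-refl
  ... | yes (c , c<b , Pc) =
    let b′ , b′-least , b′≤c = smaller c<b Pc
    in b′ , b′-least , ℕ.≤-trans b′≤c (ℕ.<⇒≤ c<b)

-- An index below another one is not the last, so `D3`, which is stated for `inject₁ i`, can be
-- applied at it.
<⇒inject₁ : ∀ {i j : Fin (suc n)} → i <ᶠ j → ∃[ i′ ] i ≡ inject₁ i′
<⇒inject₁ {n} {i} {j} i<j with view i
... | ‵fromℕ = contradiction (subst (_< toℕ j) (Fin.toℕ-fromℕ n) i<j)
  (ℕ.≤⇒≯ (s≤s⁻¹ (Fin.toℕ<n j)))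
... | ‵inject₁ i′ = i′ , refl

-- Subsets of Fin n

∣p∪q∣≤∣p∣+∣q∣ : (p q : Subset n) → ∣ p ∪ q ∣ ≤ ∣ p ∣ + ∣ q ∣
∣p∪q∣≤∣p∣+∣q∣ [] [] = z≤n
∣p∪q∣≤∣p∣+∣q∣ (outside ∷ p) (outside ∷ q) = ∣p∪q∣≤∣p∣+∣q∣ p q
∣p∪q∣≤∣p∣+∣q∣ (outside ∷ p) (inside ∷ q) =
  ℕ.≤-trans (s≤s (∣p∪q∣≤∣p∣+∣q∣ p q)) (ℕ.≤-reflexive (sym (ℕ.+-suc ∣ p ∣ ∣ q ∣)))
∣p∪q∣≤∣p∣+∣q∣ (inside ∷ p) (outside ∷ q) = s≤s (∣p∪q∣≤∣p∣+∣q∣ p q)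
∣p∪q∣≤∣p∣+∣q∣ (inside ∷ p) (inside ∷ q) =
  s≤s (ℕ.≤-trans (∣p∪q∣≤∣p∣+∣q∣ p q) (ℕ.+-monoʳ-≤ ∣ p ∣ (ℕ.n≤1+n ∣ q ∣)))

∣p++q∣≡∣p∣+∣q∣ : (p : Subset m) (q : Subset n) → ∣ p ++ q ∣ ≡ ∣ p ∣ + ∣ q ∣
∣p++q∣≡∣p∣+∣q∣ [] q = refl
∣p++q∣≡∣p∣+∣q∣ (outside ∷ p) q = ∣p++q∣≡∣p∣+∣q∣ p q
∣p++q∣≡∣p∣+∣q∣ (inside ∷ p) q = cong suc (∣p++q∣≡∣p∣+∣q∣ p q)

x∈p─q⇒x∉q : (p q : Subset n) → ∀ {x} → x ∈ p ─ q → x ∉ q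
x∈p─q⇒x∉q (_ ∷ p) (outside ∷ q) (there x∈p─q) (there x∈q) = x∈p─q⇒x∉q p q x∈p─q x∈q
x∈p─q⇒x∉q (_ ∷ p) (inside ∷ q) (there x∈p─q) (there x∈q) = x∈p─q⇒x∉q p q x∈p─q x∈q

module _ {P : Fin n → Set ℓ} (P? : ∀ x → Dec (P x)) where

  comprehension : Subset n
  comprehension = tabulate (does ∘ P?)

  ∈-comprehension⁺ : ∀ {x} → P x → x ∈ comprehension
  ∈-comprehension⁺ {x} Px =
    lookup⇒[]= x _ (trans (lookup∘tabulate _ x) (dec-true (P? x) Px))

  ∈-comprehension⁻ : ∀ {x} → x ∈ comprehension → P x
  ∈-comprehension⁻ {x} x∈ with P? x | trans (sym (lookup∘tabulate (does ∘ P?) x)) ([]=⇒lookup x∈)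
  ... | yes Px | _ = Px

-- Linear orders on Fin n and permutations

-- Pigeonhole: punching a missed value out of the codomain would inject `Fin (suc n)` into `Fin n`.
injective⇒surjective : (f : Fin n → Fin n) → Injective _≡_ _≡_ f → ∀ y → ∃[ x ] f x ≡ y
injective⇒surjective {suc n} f inj y with Fin.any? (λ x → f x Fin.≟ y)
... | yes hit = hit
... | no ∄x = contradiction (Fin.injective⇒≤ punched-injective) ℕ.1+n≰n
  where
  y≢f : ∀ x → y ≢ f x
  y≢f x y≡fx = ∄x (x , sym y≡fx)

  punched-injective : Injective _≡_ _≡_ (λ x → punchOut (y≢f x))
  punched-injective eq = inj (Fin.punchOut-injective (y≢f _) (y≢f _) eq)

injective⇒permutation : (f : Fin n → Fin n) → Injective _≡_ _≡_ f → Permutation′ n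
injective⇒permutation f inj =
  mk↔ₛ′ f (proj₁ ∘ f⁻¹) (proj₂ ∘ f⁻¹) (λ x → inj (proj₂ (f⁻¹ (f x))))
  where f⁻¹ = injective⇒surjective f inj

module Index {_≺_ : Rel (Fin n) ℓ} (isStrictTotalOrder : IsStrictTotalOrder _≡_ _≺_) where
  private module ≺ = IsStrictTotalOrder isStrictTotalOrder

  below : Fin n → Subset n
  below x = comprehension (≺._<? x)

  x∉below[x] : ∀ x → x ∉ below x
  x∉below[x] x = ≺.irrefl refl ∘ ∈-comprehension⁻ (≺._<? x)

  -- Counting predecessors turns an abstract order into positions; the count stays under `n` because
  -- `x` does not precede itself.
  index : Fin n → Fin n
  index x = fromℕ< (ℕ.<-≤-trans
    (p⊂q⇒∣p∣<∣q∣ ((λ _ → ∈⊤) , x , ∈⊤ , x∉below[x] x)) (ℕ.≤-reflexive (∣⊤∣≡n n)))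

  toℕ-index : ∀ x → toℕ (index x) ≡ ∣ below x ∣
  toℕ-index x = Fin.toℕ-fromℕ< _

  index-mono : ∀ {x y} → x ≺ y → index x <ᶠ index y
  index-mono {x} {y} x≺y = subst₂ _<_ (sym (toℕ-index x)) (sym (toℕ-index y)) (p⊂q⇒∣p∣<∣q∣
    ( (λ z∈ → ∈-comprehension⁺ (≺._<? y) (≺.trans (∈-comprehension⁻ (≺._<? x) z∈) x≺y))
    , x , ∈-comprehension⁺ (≺._<? y) x≺y , x∉below[x] x))

  index-injective : Injective _≡_ _≡_ index
  index-injective {x} {y} eq with ≺.compare x y
  ... | tri< x≺y _ _ = contradiction (index-mono x≺y) (ℕ.<-irrefl (cong toℕ eq))
  ... | tri≈ _ x≡y _ = x≡y
  ... | tri> _ _ y≺x = contradiction (index-mono y≺x) (ℕ.<-irrefl (cong toℕ (sym eq)))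

  -- Each predecessor of `y` precedes `x` or lies in the half-open interval from `x` to `y`. Since
  -- `y` is outside this interval, `q` may omit it, which later gives the 1 subtracted in
  -- `2 * w ∸ 1`.
  index-interval : ∀ {x y} (q : Subset n) → (∀ {z} → ¬ z ≺ x → z ≺ y → z ∈ q) →
                   toℕ (index y) ≤ toℕ (index x) + ∣ q ∣
  index-interval {x} {y} q interval⊆q = begin
    toℕ (index y)         ≡⟨ toℕ-index y ⟩
    ∣ below y ∣           ≤⟨ p⊆q⇒∣p∣≤∣q∣ covered ⟩
    ∣ below x ∪ q ∣       ≤⟨ ∣p∪q∣≤∣p∣+∣q∣ (below x) q ⟩
    ∣ below x ∣ + ∣ q ∣   ≡⟨ cong (_+ ∣ q ∣) (toℕ-index x) ⟨
    toℕ (index x) + ∣ q ∣ ∎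
    where
    open ℕ.≤-Reasoning
    covered : below y ⊆ below x ∪ q
    covered {z} z∈ with z ≺.<? x
    ... | yes z≺x = x∈p∪q⁺ (inj₁ (∈-comprehension⁺ (≺._<? x) z≺x))
    ... | no z⊀x = x∈p∪q⁺ {p = below x} (inj₂ (interval⊆q z⊀x (∈-comprehension⁻ (≺._<? y) z∈)))

-- Linear extensions of well-founded relations

module _ {_⊏_ : Rel (Fin n) ℓ} (_⊏?_ : Decidable _⊏_) where

  private
    -- The recursion of `height` can continue only where a proof of `x ⊏ y` is at hand; elsewhere
    -- the default 0 leaves the maximum unchanged.
    whenever : Dec A → (A → ℕ) → ℕ
    whenever (yes x) f = f x
    whenever (no _)  f = 0

    whenever-cong : ∀ (d : Dec A) {f g : A → ℕ} → f ≗ g → whenever d f ≡ whenever d g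
    whenever-cong (yes x) f≗g = f≗g x
    whenever-cong (no _)  f≗g = refl

    whenever-yes : ∀ (d : Dec A) {f : A → ℕ} {k} → A → (∀ x → f x ≡ k) → whenever d f ≡ k
    whenever-yes (yes x) _ f≡k = f≡k x
    whenever-yes (no ¬x) x _   = contradiction x ¬x

  height : ∀ {y} → Acc _⊏_ y → ℕ
  height {y} (acc rs) =
    suc (max 0 (map (λ x → whenever (x ⊏? y) (λ x⊏y → height (rs x⊏y))) (allFin n)))

  -- In `height-mono` the accessibility proof of `x` found inside that of `y` differs from the given
  -- one; this identifies the two heights.
  height-irrelevant : ∀ {y} (p q : Acc _⊏_ y) → height p ≡ height q
  height-irrelevant {y} (acc rs) (acc ss) = cong (suc ∘ max 0) (map-cong
    (λ x → whenever-cong (x ⊏? y) (λ x⊏y → height-irrelevant (rs x⊏y) (ss x⊏y))) (allFin n))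

  height-mono : ∀ {x y} (p : Acc _⊏_ x) (q : Acc _⊏_ y) → x ⊏ y → height p < height q
  height-mono {x} {y} p (acc rs) x⊏y = s≤s (ℕ.≤-trans
    (ℕ.≤-reflexive (sym (whenever-yes (x ⊏? y) x⊏y (λ x⊏y′ → height-irrelevant (rs x⊏y′) p))))
    (All.lookup (xs≤max 0 (map f (allFin n))) (∈-map⁺ f (∈-allFin x))))
    where
    f : Fin n → ℕ
    f z = whenever (z ⊏? y) (λ z⊏y → height (rs z⊏y))

  -- Sort by height and break ties by the order of `Fin n`; height strictly increases along `⊏`, so
  -- the sorting respects it.
  linear-extension : WellFounded _⊏_ →
    ∃ λ (_≺_ : Rel (Fin n) 0ℓ) → IsStrictTotalOrder _≡_ _≺_ × _⊏_ ⇒ _≺_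
  linear-extension wf =
    (×-Lex _≡_ _<_ _<ᶠ_ on key) ,
    record
      { isStrictPartialOrder = record
        { isEquivalence = isEquivalence
        ; irrefl = λ { refl → lex.irrefl (refl , refl) }
        ; trans = lex.trans
        ; <-resp-≈ = resp₂ _
        }
      ; compare = compare
      } ,
    λ x⊏y → inj₁ (height-mono (wf _) (wf _) x⊏y)
    where
    key : Fin n → ℕ × Fin n
    key x = height (wf x) , x

    lex-isStrictTotalOrder = On.isStrictTotalOrder key
      (×-isStrictTotalOrder ℕ.<-isStrictTotalOrder (Fin.<-isStrictTotalOrder {n}))
    module lex = IsStrictTotalOrder lex-isStrictTotalOrder

    -- The lexicographic order is total up to equality of keys, which is equality of elements
    -- because a key contains its element.
    compare : Trichotomous _≡_ (×-Lex _≡_ _<_ _<ᶠ_ on key)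
    compare x y with lex.compare x y
    ... | tri< x≺y x≉y y⊀x = tri< x≺y (λ { refl → x≉y (refl , refl) }) y⊀x
    ... | tri≈ x⊀y x≈y y⊀x = tri≈ x⊀y (proj₂ x≈y) y⊀x
    ... | tri> x⊀y x≉y y≺x = tri> x⊀y (λ { refl → x≉y (refl , refl) }) y≺x

-- Topological orders

module _ (G : DAG) where
  open DAG G

  -- By acyclicity the transitive closure is a strict partial order, and on a finite type such an
  -- order is well-founded.
  ⟶-wellFounded : WellFounded _⟶_
  ⟶-wellFounded = wellFounded⁻ _⟶_ (spo-wellFounded record
    { isEquivalence = isEquivalence
    ; irrefl = λ { refl → acyclic _ }
    ; trans = transitive _⟶_
    ; <-resp-≈ = resp₂ _
    })

  -- This is the formula of `TopologicalOrder.width`, freed from the record so that it applies to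
  -- functions not yet known to be topological orders.
  stretch : (Node → Node) → ℕ
  stretch f = max 0 (map (uncurry λ X Y → ∣ toℕ (f X) - toℕ (f Y) ∣) arrows)

  ≤stretch : ∀ f {X Y} → X ⟶ Y → ∣ toℕ (f X) - toℕ (f Y) ∣ ≤ stretch f
  ≤stretch f {X} {Y} X⟶Y = All.lookup (xs≤max 0 _) (∈-map⁺ _ (∈-filter⁺ (uncurry _⟶?_)
    (∈-cartesianProduct⁺ (∈-allFin X) (∈-allFin Y)) X⟶Y))

  stretch≤ : ∀ f {b} → (∀ {X Y} → X ⟶ Y → ∣ toℕ (f X) - toℕ (f Y) ∣ ≤ b) → stretch f ≤ b
  stretch≤ f f≤b = max≤v⁺ {xs = map _ arrows} z≤n (All.map⁺ (All.map f≤b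
    (All.all-filter (uncurry _⟶?_) (cartesianProduct (allFin order) (allFin order)))))

  stretch-cong : ∀ {f g} → f ≗ g → stretch f ≡ stretch g
  stretch-cong f≗g = cong (max 0) (map-cong
    (λ { (X , Y) → cong₂ (λ x y → ∣ toℕ x - toℕ y ∣) (f≗g X) (f≗g Y) }) arrows)

  Increasing : (Node → Node) → Set
  Increasing f = ∀ X Y → X ⟶ Y → f X <ᶠ f Y

  topologicalOrder : ∀ f → Injective _≡_ _≡_ f → Increasing f → TopologicalOrder G
  topologicalOrder f inj inc = record
    { ordering = injective⇒permutation f inj
    ; topological = inc _ _
    }

  -- A topological order is a function among the order ^ order many functions
  -- on nodes, so the order of a given width can be searched for exhaustively.
  width? : ∀ b → Dec (∃ λ (σ : TopologicalOrder G) → TopologicalOrder.width σ ≡ b)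
  width? b = map′ decode encode (Fin.any? good?)
    where
    Good : (Node → Node) → Set
    Good f = (∀ X Y → f X ≡ f Y → X ≡ Y) × Increasing f × stretch f ≡ b

    good? : (i : Fin (order ^ order)) → Dec (Good (finToFun i))
    good? i = Fin.all? (λ X → Fin.all? λ Y → (f X Fin.≟ f Y) →-dec (X Fin.≟ Y))
      ×-dec Fin.all? (λ X → Fin.all? λ Y → (X ⟶? Y) →-dec (f X Fin.<? f Y))
      ×-dec (stretch f ℕ.≟ b)
      where
      f : Node → Node
      f = finToFun i

    decode : ∃ (Good ∘ finToFun) → ∃ λ (σ : TopologicalOrder G) → TopologicalOrder.width σ ≡ b
    decode (i , inj , inc , eq) = topologicalOrder (finToFun i) (inj _ _) inc , eq

    encode : (∃ λ (σ : TopologicalOrder G) → TopologicalOrder.width σ ≡ b) → ∃ (Good ∘ finToFun)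
    encode (σ , eq) = funToFin σ.position ,
      (λ X Y fX≡fY → position-injective (trans (sym (same X)) (trans fX≡fY (same Y)))) ,
      (λ X Y X⟶Y → subst₂ _<ᶠ_ (sym (same X)) (sym (same Y)) (σ.topological X⟶Y)) ,
      trans (stretch-cong same) eq
      where
      module σ = TopologicalOrder σ

      same : finToFun (funToFin σ.position) ≗ σ.position
      same = Fin.finToFun-funToFin σ.position

      position-injective : Injective _≡_ _≡_ σ.position
      position-injective {X} {Y} pX≡pY = trans (sym (inverseˡ σ.ordering))
        (trans (cong (σ.ordering ⟨$⟩ˡ_) pX≡pY) (inverseˡ σ.ordering))

  bandwidth-exists : (σ : TopologicalOrder G) →
                     ∃[ b ] (HasBandwidth G b × b ≤ TopologicalOrder.width σ)
  bandwidth-exists σ = least width? (TopologicalOrder.width σ) (σ , refl)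

-- Layer decompositions and layerwise orders

module _ {G : DAG} (L : LayerDecomposition G) where
  open DAG G
  open LayerDecomposition L

  layer : Node → Fin (suc k)
  layer X = proj₁ (D1-cover X)

  X∈T[layer] : ∀ X → X ∈ T (layer X)
  X∈T[layer] X = proj₂ (D1-cover X)

  -- If `X` were outside `S i`, then `D3` at `i` would forbid the arrow. If a layer were skipped,
  -- `D3` at the layer just after `i` would forbid it, with `X` in an earlier block.
  adjacent-below : ∀ {i j X Y} → i <ᶠ j → X ∈ T i → Y ∈ T j → X ⟶ Y ⊎ Y ⟶ X →
                   toℕ j ≡ suc (toℕ i) × X ∈ S i
  adjacent-below {i} {j} {X} {Y} i<j X∈T Y∈T arrow with <⇒inject₁ i<j
  ... | i′ , refl = ℕ.≤-antisym (ℕ.≮⇒≥ no-skip) i<j , X∈S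
    where
    apart : ¬ (¬ (X ⟶ Y) × ¬ (Y ⟶ X))
    apart (X↛Y , Y↛X) = [ X↛Y , Y↛X ]′ arrow

    X∈S : X ∈ S (inject₁ i′)
    X∈S with X ∈? S (inject₁ i′)
    ... | yes X∈S = X∈S
    ... | no X∉S = contradiction (D3 i′ (inj₂ (x∈p∧x∉q⇒x∈p─q X∈T X∉S)) (j , i<j , Y∈T)) apart

    no-skip : ¬ (suc (toℕ (inject₁ i′)) < toℕ j)
    no-skip 1+i<j
      with <⇒inject₁ {i = suc i′} (subst (λ c → suc c < toℕ j) (Fin.toℕ-inject₁ i′) 1+i<j)
    ... | l , 1+i′≡l = apart (D3 l (inj₁ (inject₁ i′ , i<l , X∈T)) (j , l<j , Y∈T))
      where
      toℕ-l : suc (toℕ (inject₁ i′)) ≡ toℕ (inject₁ l)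
      toℕ-l = trans (cong suc (Fin.toℕ-inject₁ i′)) (cong toℕ 1+i′≡l)

      i<l : inject₁ i′ <ᶠ inject₁ l
      i<l = ℕ.≤-reflexive toℕ-l

      l<j : inject₁ l <ᶠ j
      l<j = subst (_< toℕ j) toℕ-l 1+i<j

  child-layer≤ : ∀ {i j X Y} → X ∈ S i → X ⟶ Y → Y ∈ T j → toℕ j ≤ toℕ i
  child-layer≤ {zero} {j} X∈S X⟶Y Y∈T
    rewrite D1-disjoint Y∈T (p─q⊆p _ _ (D4-zero X∈S X⟶Y)) = z≤n
  child-layer≤ {suc i} {j} X∈S X⟶Y Y∈T with x∈p∪q⁻ _ _ (D4-suc i X∈S X⟶Y)
  ... | inj₁ Y∈T─S rewrite D1-disjoint Y∈T (p─q⊆p _ _ Y∈T─S) = ℕ.≤-refl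
  ... | inj₂ Y∈S rewrite D1-disjoint Y∈T (D2 (inject₁ i) Y∈S) | Fin.toℕ-inject₁ i = ℕ.n≤1+n (toℕ i)

  -- An arrow that climbs to a higher layer would start in `S` of its layer by `D3`, but `D4` keeps
  -- the children of such nodes from lying higher. A descending arrow joins consecutive layers by
  -- `D3`.
  arrow-layers : ∀ {X Y} → X ⟶ Y →
                 layer X ≡ layer Y ⊎ toℕ (layer X) ≡ suc (toℕ (layer Y))
  arrow-layers {X} {Y} X⟶Y with Fin.<-cmp (layer X) (layer Y)
  ... | tri< i<j _ _ =
    let _ , X∈S = adjacent-below i<j (X∈T[layer] X) (X∈T[layer] Y) (inj₁ X⟶Y)
    in contradiction (child-layer≤ X∈S X⟶Y (X∈T[layer] Y)) (ℕ.<⇒≱ i<j)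
  ... | tri≈ _ i≡j _ = inj₁ i≡j
  ... | tri> _ _ j<i = inj₂ (proj₁ (adjacent-below j<i (X∈T[layer] Y) (X∈T[layer] X) (inj₂ X⟶Y)))

  private
    -- Arrows between layers descend, so higher layers come first; inside a layer the arrows decide.
    _⊏_ : Rel Node 0ℓ
    _⊏_ = ×-Lex _≡_ _>_ _⟶_ on (λ X → layer X , X)

    _⊏?_ : Decidable _⊏_
    X ⊏? Y = ×-decidable Fin._≟_ (λ i j → j Fin.<? i) _⟶?_ (layer X , X) (layer Y , Y)

    ⊏-wellFounded : WellFounded _⊏_
    ⊏-wellFounded = On.wellFounded (λ X → layer X , X)
      (×-wellFounded >-wellFounded (⟶-wellFounded G))

    ⟶⇒⊏ : ∀ {X Y} → X ⟶ Y → X ⊏ Y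
    ⟶⇒⊏ X⟶Y with arrow-layers X⟶Y
    ... | inj₁ i≡j = inj₂ (i≡j , X⟶Y)
    ... | inj₂ i≡1+j = inj₁ (ℕ.≤-reflexive (sym i≡1+j))

  layerwise-order : ∀ {w} → (∀ i → ∣ T i ∣ ≤ w) →
                    ∃ λ (σ : TopologicalOrder G) → TopologicalOrder.width σ ≤ 2 * w ∸ 1
  layerwise-order {w} T≤w with linear-extension _⊏?_ ⊏-wellFounded
  ... | _≺_ , isSTO , ⊏⇒≺ =
    topologicalOrder G index index-injective (λ _ _ → index-mono ∘ ⊏⇒≺ ∘ ⟶⇒⊏) ,
    stretch≤ G index short
    where
    open Index isSTO
    module ≺ = IsStrictTotalOrder isSTO
    open ℕ.≤-Reasoning

    short : ∀ {X Y} → X ⟶ Y → ∣ toℕ (index X) - toℕ (index Y) ∣ ≤ 2 * w ∸ 1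
    short {X} {Y} X⟶Y = begin
      ∣ toℕ (index X) - toℕ (index Y) ∣
        ≡⟨ ℕ.m≤n⇒∣m-n∣≡n∸m (ℕ.<⇒≤ (index-mono (⊏⇒≺ (⟶⇒⊏ X⟶Y)))) ⟩
      toℕ (index Y) ∸ toℕ (index X)
        ≤⟨ ℕ.m≤n+o⇒m∸n≤o _ (toℕ (index X)) (index-interval q between) ⟩
      ∣ q ∣
        -- Removing `Y`, a member of `layers`, makes the set strictly smaller, so `suc ∣ q ∣` is at
        -- most `2 * w`.
        ≤⟨ ℕ.∸-monoˡ-≤ 1 (ℕ.≤-trans (x∈p⇒∣p-x∣<∣p∣ Y∈) two-layers) ⟩
      2 * w ∸ 1 ∎
      where
      layers q : Subset order
      layers = T (layer X) ∪ T (layer Y)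
      q = layers ─ ⁅ Y ⁆

      Y∈ : Y ∈ layers
      Y∈ = x∈p∪q⁺ {p = T (layer X)} (inj₂ (X∈T[layer] Y))

      two-layers : ∣ layers ∣ ≤ 2 * w
      two-layers = begin
        ∣ layers ∣                            ≤⟨ ∣p∪q∣≤∣p∣+∣q∣ (T (layer X)) (T (layer Y)) ⟩
        ∣ T (layer X) ∣ + ∣ T (layer Y) ∣     ≤⟨ ℕ.+-mono-≤ (T≤w _) (T≤w _) ⟩
        w + w                                 ≡⟨ cong (w +_) (ℕ.+-identityʳ w) ⟨
        2 * w                                 ∎

      between : ∀ {Z} → ¬ Z ≺ X → Z ≺ Y → Z ∈ q
      between {Z} Z⊀X Z≺Y = x∈p∧x≢y⇒x∈p-y (x∈p∪q⁺ (which (arrow-layers X⟶Y)))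
        (λ { refl → ≺.irrefl refl Z≺Y })
        where
        -- A node in a lower layer than `Y` comes after `Y`, and one in a higher layer than `X`
        -- comes before `X`.
        lower : toℕ (layer Y) ≤ toℕ (layer Z)
        lower = ℕ.≮⇒≥ λ lt → ≺.asym Z≺Y (⊏⇒≺ (inj₁ lt))

        upper : toℕ (layer Z) ≤ toℕ (layer X)
        upper = ℕ.≮⇒≥ λ lt → Z⊀X (⊏⇒≺ (inj₁ lt))

        Z∈T : ∀ {i} → toℕ (layer Z) ≡ toℕ i → Z ∈ T i
        Z∈T eq = subst (λ i → Z ∈ T i) (Fin.toℕ-injective eq) (X∈T[layer] Z)

        -- The layers of `X` and `Y` are equal or consecutive, so no third layer fits between them.
        which : layer X ≡ layer Y ⊎ toℕ (layer X) ≡ suc (toℕ (layer Y)) →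
                Z ∈ T (layer X) ⊎ Z ∈ T (layer Y)
        which (inj₁ i≡j) = inj₁ (Z∈T (ℕ.≤-antisym upper (subst (λ i → toℕ i ≤ toℕ (layer Z)) (sym i≡j) lower)))
        which (inj₂ i≡1+j) with ℕ.m≤n⇒m<n∨m≡n upper
        ... | inj₂ eq = inj₁ (Z∈T eq)
        ... | inj₁ lt = inj₂ (Z∈T (ℕ.≤-antisym (s≤s⁻¹ (subst (_ <_) i≡1+j lt)) lower))

-- Complete bipartite DAGs

module _ (p : Subset (suc n)) where

  biclique : DAG
  biclique = record
    { order = suc n
    ; nonEmpty = _
    ; _⟶_ = λ X Y → X ∈ p × Y ∉ p
    ; _⟶?_ = λ X Y → (X ∈? p) ×-dec ¬? (Y ∈? p)
    -- The start of a cycle is both the tail and the head of an arrow, hence inside and outside `p`.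
    ; acyclic = λ _ cycle → target∉p cycle (source∈p cycle)
    }
    where
    source∈p : ∀ {X Y} → TransClosure (λ X Y → X ∈ p × Y ∉ p) X Y → X ∈ p
    source∈p [ X∈p , _ ] = X∈p
    source∈p ((X∈p , _) ∷ _) = X∈p

    target∉p : ∀ {X Y} → TransClosure (λ X Y → X ∈ p × Y ∉ p) X Y → Y ∉ p
    target∉p [ _ , Y∉p ] = Y∉p
    target∉p (_ ∷ path) = target∉p path

  module _ (p-nonempty : Nonempty p) (∁p-nonempty : Nonempty (∁ p)) where

    -- The sinks form layer 0 and the sources layer 1. Taking all sinks into `S zero` leaves `D3`
    -- nothing to forbid: no layer is earlier, and `T zero ─ S zero` is empty.
    bicliqueLayers : LayerDecomposition biclique
    bicliqueLayers = record
      { k = 1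
      ; T = T
      ; S = S
      ; D1-nonempty = λ { zero → ∁p-nonempty ; (suc zero) → p-nonempty }
      ; D1-cover = cover
      ; D1-disjoint = λ {i} {j} → disjoint i j
      ; D2 = λ { zero X∈S → X∈S ; (suc zero) X∈⊥ → contradiction X∈⊥ ∉⊥ }
      ; D3 = λ { zero (inj₁ (_ , () , _)) _
               ; zero (inj₂ X∈∅) _ → contradiction (p─q⊆p _ _ X∈∅) (x∈p─q⇒x∉q (∁ p) (∁ p) X∈∅) }
      ; D4-suc = λ { zero X∈⊥ _ → contradiction X∈⊥ ∉⊥ }
      ; D4-zero = λ X∈∁p (X∈p , _) → contradiction X∈p (x∈∁p⇒x∉p X∈∁p)
      ; D5-inject₁ = λ { zero _ (X∈p , _) → X∈p }
      ; D5-last = λ Y∈⊥ _ → ∉⊥ Y∈⊥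
      }
      where
      T S : Fin 2 → Subset (suc n)
      T zero = ∁ p
      T (suc zero) = p
      S zero = ∁ p
      S (suc zero) = ⊥

      cover : ∀ X → ∃[ i ] X ∈ T i
      cover X with X ∈? p
      ... | yes X∈p = suc zero , X∈p
      ... | no X∉p = zero , x∉p⇒x∈∁p X∉p

      disjoint : ∀ i j {X} → X ∈ T i → X ∈ T j → i ≡ j
      disjoint zero zero _ _ = refl
      disjoint zero (suc zero) X∈∁p X∈p = contradiction X∈p (x∈∁p⇒x∉p X∈∁p)
      disjoint (suc zero) zero X∈p X∈∁p = contradiction X∈p (x∈∁p⇒x∉p X∈∁p)
      disjoint (suc zero) (suc zero) _ _ = refl

    biclique-width : (σ : TopologicalOrder biclique) → TopologicalOrder.width σ ≡ n
    biclique-width σ = ℕ.≤-antisym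
      (stretch≤ biclique position λ {X} {Y} _ →
        ℕ.≤-trans (ℕ.∣m-n∣≤m⊔n (toℕ (position X)) (toℕ (position Y)))
          (ℕ.⊔-lub (s≤s⁻¹ (Fin.toℕ<n (position X))) (s≤s⁻¹ (Fin.toℕ<n (position Y)))))
      (subst (_≤ width) first-to-last (≤stretch biclique position (first∈p , last∉p)))
      where
      open TopologicalOrder σ

      first last : Fin (suc n)
      first = ordering ⟨$⟩ˡ zero
      last = ordering ⟨$⟩ˡ fromℕ n

      first-to-last : distance first last ≡ n
      first-to-last = trans
        (cong₂ (λ x y → ∣ toℕ x - toℕ y ∣) (inverseʳ ordering {zero}) (inverseʳ ordering {fromℕ n}))
        (Fin.toℕ-fromℕ n)

      -- Were the first node a sink, any source would have to precede it; dually, a source in last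
      -- place would precede some sink.
      first∈p : first ∈ p
      first∈p with first ∈? p
      ... | yes first∈p = first∈p
      ... | no first∉p = contradiction
        (subst (position (proj₁ p-nonempty) <ᶠ_) (inverseʳ ordering)
          (topological (proj₂ p-nonempty , first∉p))) λ ()

      last∉p : last ∉ p
      last∉p last∈p = ℕ.<⇒≱
        (subst (_<ᶠ position Y) (inverseʳ ordering)
          (topological (last∈p , x∈∁p⇒x∉p (proj₂ ∁p-nonempty))))
        (subst (toℕ (position Y) ≤_) (sym (Fin.toℕ-fromℕ n)) (s≤s⁻¹ (Fin.toℕ<n (position Y))))
        where Y = proj₁ ∁p-nonempty

-- The upper bound and its tightness

2m∸1≤2n∸1⇒m≤n : ∀ m n → 2 * m ∸ 1 ≤ 2 * n ∸ 1 → m ≤ n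
2m∸1≤2n∸1⇒m≤n zero n _ = z≤n
2m∸1≤2n∸1⇒m≤n (suc m) zero le =
  contradiction (subst (_≤ 0) (ℕ.+-suc m (m + 0)) le) λ ()
2m∸1≤2n∸1⇒m≤n (suc m) (suc n) le =
  s≤s (ℕ.*-cancelˡ-≤ 2 (s≤s⁻¹ (subst₂ _≤_ (ℕ.+-suc m (m + 0)) (ℕ.+-suc n (n + 0)) le)))

theorem10 : (∀ (G : DAG) (w : ℕ) → HasLayerwidth G w →
    ∃[ b ] (HasBandwidth G b × b ≤ 2 * w ∸ 1))
    × (∀ (w : ℕ) → 1 ≤ w →
    ∃ λ (G : DAG) → HasLayerwidth G w × HasBandwidth G (2 * w ∸ 1))
theorem10 = upper-bound , tight
  where
  upper-bound : ∀ (G : DAG) (w : ℕ) → HasLayerwidth G w →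
                ∃[ b ] (HasBandwidth G b × b ≤ 2 * w ∸ 1)
  upper-bound G w ((L , T≤w , _) , _) =
    let σ , σ≤ = layerwise-order L T≤w
        b , b-bandwidth , b≤σ = bandwidth-exists G σ
    in b , b-bandwidth , ℕ.≤-trans b≤σ σ≤

  tight : ∀ (w : ℕ) → 1 ≤ w → ∃ λ (G : DAG) → HasLayerwidth G w × HasBandwidth G (2 * w ∸ 1)
  -- With `w` a successor, `2 * w` computes to `suc n` as `biclique` demands, where `n` is
  -- `2 * w ∸ 1`.
  tight w@(suc v) _ = G ,
    ((L , T≤w , λ _ → w-least L) , λ { _ (L′ , T′≤w′ , _) → w-least L′ T′≤w′ }) ,
    (proj₁ (layerwise-order L T≤w) , width-G (proj₁ (layerwise-order L T≤w))) ,
    λ { _ (σ , refl) → ℕ.≤-reflexive (sym (width-G σ)) }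
    where
    p : Subset (2 * w)
    -- The first `w` nodes are the sources; `w + 0` is the second summand to which `2 * w` unfolds.
    p = ⊤ {w} ++ ⊥ {w + 0}

    p-nonempty : Nonempty p
    p-nonempty = zero , here

    ∁p-nonempty : Nonempty (∁ p)
    ∁p-nonempty = w ↑ʳ zero , x∉p⇒x∈∁p λ X∈p → contradiction
      (trans (sym (lookup-++ʳ (⊤ {w}) (⊥ {w + 0}) zero)) ([]=⇒lookup X∈p)) λ ()

    G : DAG
    G = biclique p

    L : LayerDecomposition G
    L = bicliqueLayers p p-nonempty ∁p-nonempty

    width-G : (σ : TopologicalOrder G) → TopologicalOrder.width σ ≡ 2 * w ∸ 1
    width-G = biclique-width p p-nonempty ∁p-nonempty

    ∣p∣≡w : ∣ p ∣ ≡ w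
    ∣p∣≡w = begin
      ∣ p ∣                       ≡⟨ ∣p++q∣≡∣p∣+∣q∣ (⊤ {w}) (⊥ {w + 0}) ⟩
      ∣ ⊤ {w} ∣ + ∣ ⊥ {w + 0} ∣   ≡⟨ cong₂ _+_ (∣⊤∣≡n w) (∣⊥∣≡0 (w + 0)) ⟩
      w + 0                       ≡⟨ ℕ.+-identityʳ w ⟩
      w                           ∎
      where open ≡-Reasoning

    T≤w : ∀ i → ∣ LayerDecomposition.T L i ∣ ≤ w
    T≤w zero = ℕ.≤-reflexive (begin
      ∣ ∁ p ∣         ≡⟨ ∣∁p∣≡n∸∣p∣ p ⟩
      2 * w ∸ ∣ p ∣   ≡⟨ cong (2 * w ∸_) ∣p∣≡w ⟩
      2 * w ∸ w       ≡⟨ ℕ.m+n∸m≡n w (w + 0) ⟩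
      w + 0           ≡⟨ ℕ.+-identityʳ w ⟩
      w               ∎)
      where open ≡-Reasoning
    T≤w (suc zero) = ℕ.≤-reflexive ∣p∣≡w

    -- The upper bound read backwards: blocks of size at most `w′` yield a topological order of
    -- width at most `2 * w′ ∸ 1`, yet every topological order of `G` has width `2 * w ∸ 1`.
    w-least : (L′ : LayerDecomposition G) → ∀ {w′} →
              (∀ i → ∣ LayerDecomposition.T L′ i ∣ ≤ w′) → w ≤ w′
    w-least L′ {w′} T′≤w′ =
      let σ , σ≤ = layerwise-order L′ T′≤w′
      in 2m∸1≤2n∸1⇒m≤n w w′ (subst (_≤ 2 * w′ ∸ 1) (width-G σ) σ≤)
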